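{- A countable model $\langle M,\in^M\rangle$ of set theory embeds into another model $\langle N,\in^N\rangle$ of set theory if and only if the ordinals of $M$ map order-preservingly into the ordinals of $N$, i.e. there is a map $f:\mathrm{Ord}^M\to\mathrm{Ord}^N$ such that $\alpha<\beta$ in $\mathrm{Ord}^M$ implies $f(\alpha)<f(\beta)$ in $\mathrm{Ord}^N$.
   Context: A model of set theory is a first-order structure $\langle M,\in^M\rangle$ satisfying at least the Kripke–Platek axioms KP; it need not be well-founded. $N$ is not assumed countable. $\mathrm{Ord}^M$ denotes the linear order of the ordinals of $M$. $M$ embeds into $N$ if $M$ is isomorphic to an induced substructure of $N$, i.e. there is an injective $j:M\to N$ with $x\in^M y\iff j(x)\in^N j(y)$. All maps are external. -}

module Defs where

open import Data.Empty.Polymorphic using (⊥)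
open import Data.Fin using (Fin; zero; suc)
open import Data.Nat using (ℕ; suc)
open import Data.Product using (_×_; ∃-syntax)
open import Data.Refinement using (Refinement; value)
open import Data.Sum using (_⊎_)
open import Data.Vec using (Vec; _∷_; lookup)
open import Function.Bundles using (_⇔_; _↣_)
open import Function.Definitions using (Injective)
open import Level using (Level; Lift; _⊔_) renaming (suc to lsuc)
open import Relation.Binary.Core using (_Preserves_⟶_)
open import Relation.Binary.PropositionalEquality using (_≡_)
open import Relation.Nullary using (¬_)

private
  variable
    a b c d : Level
    n : ℕ

record Structure (a b : Level) : Set (lsuc (a ⊔ b)) where
  infix 4 _∈_
  field
    Carrier : Set a
    _∈_     : Carrier → Carrier → Set b

open Structure using (Carrier)

-- First-order formulas in the language {∈, =}, with at most n free variables
-- (de Bruijn indices; a quantifier binds index zero).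

infix  8 _∈′_ _≐_
infixr 7 _∧′_
infixr 6 _∨′_
infixr 5 _⇒′_

data Formula (n : ℕ) : Set where
  _∈′_ _≐_           : Fin n → Fin n → Formula n
  ⊥′                 : Formula n
  _∧′_ _∨′_ _⇒′_     : Formula n → Formula n → Formula n
  ∀′ ∃′              : Formula (suc n) → Formula n

-- Every quantifier is bounded by a variable i of the ambient context, which
-- is weakened to suc i under the binder.

data Δ₀ {n : ℕ} : Formula n → Set where
  mem  : ∀ i j → Δ₀ (i ∈′ j)
  eq   : ∀ i j → Δ₀ (i ≐ j)
  bot  : Δ₀ ⊥′
  and  : ∀ {φ ψ} → Δ₀ φ → Δ₀ ψ → Δ₀ (φ ∧′ ψ)
  or   : ∀ {φ ψ} → Δ₀ φ → Δ₀ ψ → Δ₀ (φ ∨′ ψ)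
  imp  : ∀ {φ ψ} → Δ₀ φ → Δ₀ ψ → Δ₀ (φ ⇒′ ψ)
  all∈ : ∀ i {φ : Formula (suc n)} → Δ₀ φ → Δ₀ (∀′ (zero ∈′ suc i ⇒′ φ))
  ex∈  : ∀ i {φ : Formula (suc n)} → Δ₀ φ → Δ₀ (∃′ (zero ∈′ suc i ∧′ φ))

module _ (M : Structure a b) where
  open Structure M using (_∈_)

  Sat : Formula n → Vec (Carrier M) n → Set (a ⊔ b)
  Sat (i ∈′ j) ρ = Lift a (lookup ρ i ∈ lookup ρ j)
  Sat (i ≐ j)  ρ = Lift b (lookup ρ i ≡ lookup ρ j)
  Sat ⊥′       ρ = ⊥
  Sat (φ ∧′ ψ) ρ = Sat φ ρ × Sat ψ ρ
  Sat (φ ∨′ ψ) ρ = Sat φ ρ ⊎ Sat ψ ρ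
  Sat (φ ⇒′ ψ) ρ = Sat φ ρ → Sat ψ ρ
  Sat (∀′ φ)   ρ = ∀ x → Sat φ (x ∷ ρ)
  Sat (∃′ φ)   ρ = ∃[ x ] Sat φ (x ∷ ρ)

  -- Kripke–Platek set theory, without the axiom of infinity and with
  -- foundation for arbitrary formulas.  In the schemes, ρ lists the parameters.

  record IsModelOfKP : Set (a ⊔ b) where
    field
      extensionality : ∀ x y → (∀ z → z ∈ x ⇔ z ∈ y) → x ≡ y
      emptySet       : ∃[ e ] ∀ z → ¬ (z ∈ e)
      pairing        : ∀ x y → ∃[ p ] ∀ z → z ∈ p ⇔ (z ≡ x ⊎ z ≡ y)
      union          : ∀ x → ∃[ u ] ∀ z → z ∈ u ⇔ (∃[ y ] (y ∈ x × z ∈ y))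
      Δ₀-separation  : ∀ {n} {φ : Formula (suc n)} → Δ₀ φ →
                       (ρ : Vec (Carrier M) n) → ∀ x →
                       ∃[ y ] ∀ z → z ∈ y ⇔ (z ∈ x × Sat φ (z ∷ ρ))
      Δ₀-collection  : ∀ {n} {φ : Formula (suc (suc n))} → Δ₀ φ →
                       (ρ : Vec (Carrier M) n) → ∀ u →
                       (∀ x → x ∈ u → ∃[ y ] Sat φ (y ∷ x ∷ ρ)) →
                       ∃[ v ] ∀ x → x ∈ u → ∃[ y ] (y ∈ v × Sat φ (y ∷ x ∷ ρ))
      foundation     : ∀ {n} (φ : Formula (suc n)) (ρ : Vec (Carrier M) n) →
                       (∀ x → (∀ y → y ∈ x → Sat φ (y ∷ ρ)) → Sat φ (x ∷ ρ)) →
                       ∀ x → Sat φ (x ∷ ρ)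

  IsTransitive : Carrier M → Set (a ⊔ b)
  IsTransitive x = ∀ y z → y ∈ x → z ∈ y → z ∈ x

  -- Over KP, whose foundation scheme makes ∈ well-founded in the sense of M,
  -- the von Neumann ordinals are the transitive sets of transitive sets.

  IsOrdinal : Carrier M → Set (a ⊔ b)
  IsOrdinal x = IsTransitive x × (∀ y → y ∈ x → IsTransitive y)

  -- A refinement rather than a Σ-type, so that an ordinal is determined by
  -- its underlying element of M.

  Ord : Set (a ⊔ b)
  Ord = Refinement (Carrier M) IsOrdinal

  OrdLess : Ord → Ord → Set b
  OrdLess α β = value α ∈ value β

  -- Finite sets count as countable.

  Countable : Set a
  Countable = Carrier M ↣ ℕ

module _ (M : Structure a b) (N : Structure c d) where
  private
    module M = Structure M
    module N = Structure N

  EmbedsInto : Set (a ⊔ b ⊔ c ⊔ d)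
  EmbedsInto = ∃[ j ] (Injective _≡_ _≡_ j ×
                       (∀ (x y : M.Carrier) → x M.∈ y ⇔ j x N.∈ j y))

  OrdMapsInto : Set (a ⊔ b ⊔ c ⊔ d)
  OrdMapsInto = ∃[ f ] (f Preserves OrdLess M ⟶ OrdLess N)

{-# OPTIONS --safe #-}

-- Given an embedding j, the map α ↦ rank (j α) preserves the order of ordinals.
--
-- Conversely, let f map the ordinals of M into those of N and let aₙ enumerate
-- M.  Suppose first that some ordinal of N contains every standard numeral.  By
-- recursion on β, N has sets
--   v(β,l) = {(β,l)} ∪ {v(α,k) : α ∈ β, k ∈ K, k ~ l},
-- where K is a set containing every standard finite set of numerals and k ~ l
-- means that the largest numeral in one of k and l belongs to the other.  With
-- kₙ = {n} ∪ {i < n : aᵢ ∈ aₙ or aₙ ∈ aᵢ}, one has kₘ ~ kₙ for m ≠ n exactly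
-- when aₘ and aₙ are related by ∈, and the direction of the relation is decided
-- by the ranks; so aₙ ↦ v(f(rank aₙ),kₙ) is an embedding.
--
-- If no ordinal of N contains every numeral, the same holds in M because of f;
-- then the ordinals of M are standard numerals, the elements of M hereditarily
-- finite, and the embedding is defined by recursion on rank.

module Submission where

open import Axiom.ExcludedMiddle using (ExcludedMiddle)
open import Data.Empty using (⊥-elim)
open import Data.Fin using (Fin; zero; suc)
open import Data.Fin.Patterns
open import Data.Irrelevant using ([_])
open import Data.List using (List; []; _∷_; _++_; map; filter)
open import Data.List.Membership.Propositional using () renaming (_∈_ to _∈ˡ_)
open import Data.List.Membership.Propositional.Properties
  using (∈-map⁺; ∈-map⁻; ∈-++⁺ˡ; ∈-++⁺ʳ; ∈-filter⁺; ∈-filter⁻)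
open import Data.List.Relation.Unary.Any using (here; there)
open import Data.Maybe as Maybe using (Maybe; just; nothing; zipWith; From-just; from-just)
open import Data.Nat using (ℕ; zero; suc; _<_; _≤_; s≤s)
open import Data.Nat.Properties
  using (n<1+n; m<n⇒m<1+n; m<1+n⇒m<n∨m≡n; m<1+n⇒m≤n; <-cmp; <⇒≤;
         <⇒≱; <-≤-trans; ≤-refl; ≤-antisym; ≤-total)
open import Data.Product using (_×_; _,_; ∃-syntax; proj₁; proj₂)
open import Data.Refinement using (_,_; value)
open import Data.Sum using (_⊎_; inj₁; inj₂; [_,_]′)
open import Data.Vec using (Vec; []; _∷_; lookup)
open import Function.Base using (_∘_; _$_; id)
open import Function.Bundles using (_⇔_; mk⇔; Equivalence; Injection)
open import Level using (Lift; lift; lower; _⊔_)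
open import Relation.Binary.Definitions using (tri<; tri≈; tri>)
open import Relation.Binary.PropositionalEquality
  using (_≡_; _≢_; refl; sym; trans; subst; subst₂)
open import Relation.Nullary.Decidable using (decidable-stable; recompute)
open import Relation.Nullary using (¬_; yes; no)
open import Defs

open Equivalence using (to; from)

private
  variable
    n m : ℕ

-- Bounded quantifiers, recognition of Δ₀ formulas, renaming of variables

∀∈ ∃∈ : Fin n → Formula (suc n) → Formula n
∀∈ i φ = ∀′ (zero ∈′ suc i ⇒′ φ)
∃∈ i φ = ∃′ (zero ∈′ suc i ∧′ φ)

-- Lets `Δ₀!` compute the derivation for a concrete formula. On failure `From-just` is a unit type,
-- so an unrecognised formula causes a type error where it is used.
Δ₀? : (φ : Formula n) → Maybe (Δ₀ φ)
Δ₀? (i ∈′ j) = just (mem i j)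
Δ₀? (i ≐ j)  = just (eq i j)
Δ₀? ⊥′       = just bot
Δ₀? (φ ∧′ ψ) = zipWith and (Δ₀? φ) (Δ₀? ψ)
Δ₀? (φ ∨′ ψ) = zipWith or (Δ₀? φ) (Δ₀? ψ)
Δ₀? (φ ⇒′ ψ) = zipWith imp (Δ₀? φ) (Δ₀? ψ)
Δ₀? (∀′ (zero ∈′ suc i ⇒′ φ)) = Maybe.map (all∈ i) (Δ₀? φ)
Δ₀? (∃′ (zero ∈′ suc i ∧′ φ)) = Maybe.map (ex∈ i) (Δ₀? φ)
Δ₀? _        = nothing

Δ₀! : (φ : Formula n) → From-just (Δ₀? φ)
Δ₀! φ = from-just (Δ₀? φ)

extend : (Fin n → Fin m) → Fin (suc n) → Fin (suc m)
extend σ zero    = zero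
extend σ (suc i) = suc (σ i)

-- Serves `collection`, where two variables change places and a parameter is inserted.
rename : (Fin n → Fin m) → Formula n → Formula m
rename σ (i ∈′ j) = σ i ∈′ σ j
rename σ (i ≐ j)  = σ i ≐ σ j
rename σ ⊥′       = ⊥′
rename σ (φ ∧′ ψ) = rename σ φ ∧′ rename σ ψ
rename σ (φ ∨′ ψ) = rename σ φ ∨′ rename σ ψ
rename σ (φ ⇒′ ψ) = rename σ φ ⇒′ rename σ ψ
rename σ (∀′ φ)   = ∀′ (rename (extend σ) φ)
rename σ (∃′ φ)   = ∃′ (rename (extend σ) φ)

rename-Δ₀ : (σ : Fin n → Fin m) {φ : Formula n} → Δ₀ φ → Δ₀ (rename σ φ)
rename-Δ₀ σ (mem i j)  = mem _ _
rename-Δ₀ σ (eq i j)   = eq _ _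
rename-Δ₀ σ bot        = bot
rename-Δ₀ σ (and d e)  = and (rename-Δ₀ σ d) (rename-Δ₀ σ e)
rename-Δ₀ σ (or d e)   = or (rename-Δ₀ σ d) (rename-Δ₀ σ e)
rename-Δ₀ σ (imp d e)  = imp (rename-Δ₀ σ d) (rename-Δ₀ σ e)
rename-Δ₀ σ (all∈ i d) = all∈ _ (rename-Δ₀ (extend σ) d)
rename-Δ₀ σ (ex∈ i d)  = ex∈ _ (rename-Δ₀ (extend σ) d)

-- Formulas for pairs, ordinals, rankings and nodes

empty′ : Fin n → Formula n
empty′ x = ∀∈ x ⊥′

-- These express u = {x, y}, p = {∅, {x}, {x, y}} and t = s ∪ {x}.
double′ pair′ adjoin′ : Fin n → Fin n → Fin n → Formula n
double′ u x y = x ∈′ u ∧′ y ∈′ u ∧′ ∀∈ u (0F ≐ suc x ∨′ 0F ≐ suc y)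
pair′ p x y =
  ∃∈ p (empty′ 0F) ∧′
  ∃∈ p (double′ 0F (suc x) (suc x)) ∧′
  ∃∈ p (double′ 0F (suc x) (suc y)) ∧′
  ∀∈ p (empty′ 0F ∨′ double′ 0F (suc x) (suc x) ∨′ double′ 0F (suc x) (suc y))
adjoin′ t s x =
  ∀∈ s (0F ∈′ suc t) ∧′ x ∈′ t ∧′ ∀∈ t (0F ∈′ suc s ∨′ 0F ≐ suc x)

transitive′ ordinal′ : Fin n → Formula n
transitive′ x = ∀∈ x (∀∈ 0F (0F ∈′ suc (suc x)))
ordinal′ x = transitive′ x ∧′ ∀∈ x (transitive′ 0F)

has-pair′ : Fin n → Fin n → Fin n → Formula n
has-pair′ g x y = ∃∈ g (pair′ 0F (suc x) (suc y))

-- A ranking is a set of pairs (y , γ), not necessarily a function, such that γ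
-- is an ordinal and for every z ∈ y there is some (z , δ) in it with δ ∈ γ.
-- Unlike rank functions, rankings are closed under arbitrary unions.

ranking′ : Fin n → Formula n
ranking′ g = ∀∈ g (∀∈ 0F (∀∈ 0F (∀∈ 1F (pair′ 3F 1F 0F ⇒′
  ordinal′ 0F ∧′ ∀∈ 1F (∃∈ 1F (has-pair′ (suc (suc (suc (suc (suc (suc g)))))) 1F 0F))))))

-- top-in′ k l says that l contains the largest element of the set of numerals k.

top-in′ linked′ : Fin n → Fin n → Formula n
top-in′ k l = ∃∈ k (0F ∈′ suc l ∧′ ∀∈ (suc k) (0F ≐ 1F ∨′ 0F ∈′ 1F))
linked′ k l = top-in′ k l ∨′ top-in′ l k

-- Selects the sets v(α,k) that are to be elements of v(β,l); a node is recognised by the label it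
-- contains.
predecessor′ : Fin n → Fin n → Fin n → Fin n → Formula n
predecessor′ z β l K =
  ∃∈ β (∃∈ (suc K) (linked′ 0F (suc (suc l)) ∧′ has-pair′ (suc (suc z)) 1F 0F))

-- y is the set v(β,l), provided that T consists of sets v(α,k) and contains
-- all those with α ∈ β and k ∈ K.

node′ : Fin n → Fin n → Fin n → Fin n → Fin n → Formula n
node′ y β l T K =
  has-pair′ y β l ∧′
  ∀∈ y (pair′ 0F (suc β) (suc l) ∨′
        (0F ∈′ suc T ∧′ predecessor′ 0F (suc β) (suc l) (suc K))) ∧′
  ∀∈ β (∀∈ (suc K) (linked′ 0F (suc (suc l)) ⇒′
    ∃∈ (suc (suc y)) (0F ∈′ suc (suc (suc T)) ∧′ has-pair′ 0F 2F 1F)))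

-- The label (β,l) of a node y ∈ T is found among the elements of the elements of
-- y.  Since T occurs only positively in node′, unions of closed sets are closed.

closed′ : Fin n → Fin n → Formula n
closed′ T K = ∀∈ T (∃∈ 0F (∃∈ 0F (∃∈ 0F (∃∈ 1F
  (node′ 4F 1F 0F (suc (suc (suc (suc (suc T))))) (suc (suc (suc (suc (suc K))))))))))

-- The recursion on β treats all l ∈ K at once, because v(β,l) has elements v(α,k) with k different
-- from l.
stage′ : Fin n → Fin n → Fin n → Formula n
stage′ T β K =
  closed′ T K ∧′ ∀∈ K (∃∈ (suc T) (has-pair′ 0F (suc (suc β)) 1F))

-- Not Δ₀, but only foundation is applied to it, and that scheme admits arbitrary formulas.
unique-node′ : Fin n → Fin n → Formula n
unique-node′ β K = ∀′ (∀′ (∀′ (∀′ (∀′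
  (closed′ 4F K′ ⇒′ closed′ 3F K′ ⇒′ 2F ∈′ 4F ⇒′ 1F ∈′ 3F ⇒′
   has-pair′ 2F β′ 0F ⇒′ has-pair′ 1F β′ 0F ⇒′ 2F ≐ 1F)))))
  where
  β′ = suc (suc (suc (suc (suc β))))
  K′ = suc (suc (suc (suc (suc K))))

-- A Δ₀ substitute for the set of finite subsets of x: such a K contains whatever arises from ∅ by
-- finitely many adjunctions of elements of x.
finite-closed′ : Fin n → Fin n → Formula n
finite-closed′ x K =
  ∃∈ K (empty′ 0F) ∧′ ∀∈ K (∀∈ (suc x) (∃∈ (suc (suc K)) (adjoin′ 0F 2F 1F)))

-- Elementary set theory in a model of KP

module KP (em : ∀ {ℓ} → ExcludedMiddle ℓ)
          {a b} (M : Structure a b) (kp : IsModelOfKP M) where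

  open Structure M public using () renaming (Carrier to V)
  open Structure M using () renaming (_∈_ to _∈ᴹ_)
  open IsModelOfKP kp

  infixl 6 _∪_
  infix 4 _∈_ _∉_

  -- Lifted to agree definitionally with the meaning of `_∈′_` under `Sat`, so that membership
  -- proofs pass unchanged between sets and formulas.
  _∈_ _∉_ : V → V → Set (a ⊔ b)
  x ∈ y = Lift a (x ∈ᴹ y)
  x ∉ y = ¬ x ∈ y

  ⟦_⟧ : Formula n → Vec V n → Set (a ⊔ b)
  ⟦_⟧ = Sat M

  rename-Sat : (σ : Fin n → Fin m) (φ : Formula n) {ρ : Vec V n} {ρ′ : Vec V m} →
               (∀ i → lookup ρ i ≡ lookup ρ′ (σ i)) →
               ⟦ φ ⟧ ρ ⇔ ⟦ rename σ φ ⟧ ρ′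
  rename-Sat σ (i ∈′ j) h = mk⇔ (subst₂ _∈_ (h i) (h j))
                                (subst₂ _∈_ (sym (h i)) (sym (h j)))
  rename-Sat σ (i ≐ j) h =
    mk⇔ (λ (lift e) → lift (trans (sym (h i)) (trans e (h j))))
        (λ (lift e) → lift (trans (h i) (trans e (sym (h j)))))
  rename-Sat σ ⊥′ h = mk⇔ id id
  rename-Sat σ (φ ∧′ ψ) h =
    let f = rename-Sat σ φ h ; g = rename-Sat σ ψ h in
    mk⇔ (λ (p , q) → to f p , to g q) (λ (p , q) → from f p , from g q)
  rename-Sat σ (φ ∨′ ψ) h =
    let f = rename-Sat σ φ h ; g = rename-Sat σ ψ h in
    mk⇔ [ inj₁ ∘ to f , inj₂ ∘ to g ]′ [ inj₁ ∘ from f , inj₂ ∘ from g ]′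
  rename-Sat σ (φ ⇒′ ψ) h =
    let f = rename-Sat σ φ h ; g = rename-Sat σ ψ h in
    mk⇔ (λ k → to g ∘ k ∘ from f) (λ k → from g ∘ k ∘ to f)
  rename-Sat σ (∀′ φ) h =
    let f = λ x → rename-Sat (extend σ) φ (λ { zero → refl {x = x} ; (suc i) → h i }) in
    mk⇔ (λ k x → to (f x) (k x)) (λ k x → from (f x) (k x))
  rename-Sat σ (∃′ φ) h =
    let f = λ x → rename-Sat (extend σ) φ (λ { zero → refl {x = x} ; (suc i) → h i }) in
    mk⇔ (λ (x , k) → x , to (f x) k) (λ (x , k) → x , from (f x) k)

  opaque
    ∈-ind : (φ : Formula (suc n)) (ρ : Vec V n) →
            (∀ x → (∀ y → y ∈ x → ⟦ φ ⟧ (y ∷ ρ)) → ⟦ φ ⟧ (x ∷ ρ)) → ∀ x → ⟦ φ ⟧ (x ∷ ρ)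
    ∈-ind φ ρ step = foundation φ ρ λ x ih → step x (λ y → ih y ∘ lower)

    -- Without a minimal element, `∈-ind` would prove the negation of φ for every set.
    ∈-min : (φ : Formula (suc n)) (ρ : Vec V n) → ∀ x → ⟦ φ ⟧ (x ∷ ρ) →
            ∃[ y ] (⟦ φ ⟧ (y ∷ ρ) × (∀ z → z ∈ y → ¬ ⟦ φ ⟧ (z ∷ ρ)))
    ∈-min φ ρ x p with em {P = ∃[ y ] (⟦ φ ⟧ (y ∷ ρ) × (∀ z → z ∈ y → ¬ ⟦ φ ⟧ (z ∷ ρ)))}
    ... | yes m = m
    ... | no ¬m = ⊥-elim $ lower $
      ∈-ind (φ ⇒′ ⊥′) ρ (λ y ih q → ⊥-elim (¬m (y , q , λ z z∈y r → lower (ih z z∈y r)))) x p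

  ∈-irrefl : ∀ {x} → x ∉ x
  ∈-irrefl {x} = lower ∘ ∈-ind (0F ∈′ 0F ⇒′ ⊥′) [] (λ y ih p → ih y p p) x

  ext : ∀ {x y} → (∀ z → z ∈ x → z ∈ y) → (∀ z → z ∈ y → z ∈ x) → x ≡ y
  ext f g = extensionality _ _ λ z → mk⇔ (lower ∘ f z ∘ lift) (lower ∘ g z ∘ lift)

  opaque
    sep : {φ : Formula (suc n)} → Δ₀ φ → Vec V n → V → V
    sep d ρ x = proj₁ (Δ₀-separation d ρ x)

    ∈-sep : {φ : Formula (suc n)} (d : Δ₀ φ) (ρ : Vec V n) → ∀ x z →
            z ∈ sep d ρ x ⇔ (z ∈ x × ⟦ φ ⟧ (z ∷ ρ))
    ∈-sep d ρ x z =
      let h = proj₂ (Δ₀-separation d ρ x) z in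
      mk⇔ (λ (lift p) → let (q , r) = to h p in lift q , r)
          (λ (lift q , r) → lift (from h (q , r)))

    -- Strong collection: the set given by the axiom may contain irrelevant elements, which are
    -- removed by separation. The separating formula is Δ₀ because u becomes a parameter.
    collection : {φ : Formula (suc (suc n))} → Δ₀ φ → (ρ : Vec V n) → ∀ u →
                 (∀ x → x ∈ u → ∃[ y ] ⟦ φ ⟧ (y ∷ x ∷ ρ)) →
                 ∃[ w ] ((∀ y → y ∈ w → ∃[ x ] (x ∈ u × ⟦ φ ⟧ (y ∷ x ∷ ρ))) ×
                         (∀ x → x ∈ u → ∃[ y ] (y ∈ w × ⟦ φ ⟧ (y ∷ x ∷ ρ))))
    collection {n} {φ} d ρ u h =
      let (v , k) = Δ₀-collection d ρ u (λ x → h x ∘ lift) in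
      sep d′ (u ∷ ρ) v ,
      (λ y y∈w → let (_ , x , x∈u , p) = to (∈-sep d′ (u ∷ ρ) v y) y∈w in
                 x , x∈u , from (swap x y) p) ,
      (λ x x∈u → let (y , y∈v , p) = k x (lower x∈u) in
                 y , from (∈-sep d′ (u ∷ ρ) v y) (lift y∈v , x , x∈u , to (swap x y) p) , p)
      where
      -- φ expects y, x, ρ, but under the quantifier bounded by u the context is x, y, u, ρ.
      σ : Fin (suc (suc n)) → Fin (suc (suc (suc n)))
      σ zero          = 1F
      σ (suc zero)    = 0F
      σ (suc (suc i)) = suc (suc (suc i))

      swap : ∀ x y → ⟦ φ ⟧ (y ∷ x ∷ ρ) ⇔ ⟦ rename σ φ ⟧ (x ∷ y ∷ u ∷ ρ)
      swap x y = rename-Sat σ φ λ { zero → refl ; (suc zero) → refl ; (suc (suc i)) → refl }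

      d′ : Δ₀ (∃∈ 1F (rename σ φ))
      d′ = ex∈ 1F (rename-Δ₀ σ d)

    ∅ : V
    ∅ = proj₁ emptySet

    ∉∅ : ∀ {x} → x ∉ ∅
    ∉∅ {x} = proj₂ emptySet x ∘ lower

    double : V → V → V
    double x y = proj₁ (pairing x y)

    ∈-double : ∀ {x y z} → z ∈ double x y ⇔ (z ≡ x ⊎ z ≡ y)
    ∈-double {x} {y} {z} = let h = proj₂ (pairing x y) z in mk⇔ (to h ∘ lower) (lift ∘ from h)

    ⋃ : V → V
    ⋃ x = proj₁ (union x)

    ∈-⋃ : ∀ {x z} → z ∈ ⋃ x ⇔ (∃[ y ] (y ∈ x × z ∈ y))
    ∈-⋃ {x} {z} = let h = proj₂ (union x) z in
      mk⇔ (λ (lift p) → let (y , q , r) = to h p in y , lift q , lift r)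
          (λ (y , lift q , lift r) → lift (from h (y , q , r)))

  opaque
    _∪_ : V → V → V
    x ∪ y = ⋃ (double x y)

    ∈-∪ : ∀ {x y z} → z ∈ x ∪ y ⇔ (z ∈ x ⊎ z ∈ y)
    ∈-∪ {x} {y} {z} = mk⇔ f g
      where
      f : z ∈ x ∪ y → z ∈ x ⊎ z ∈ y
      f p with to ∈-⋃ p
      ... | w , q , r with to ∈-double q
      ... | inj₁ refl = inj₁ r
      ... | inj₂ refl = inj₂ r
      g : z ∈ x ⊎ z ∈ y → z ∈ x ∪ y
      g (inj₁ p) = from ∈-⋃ (x , from ∈-double (inj₁ refl) , p)
      g (inj₂ p) = from ∈-⋃ (y , from ∈-double (inj₂ refl) , p)

    adjoin : V → V → V
    adjoin s x = s ∪ double x x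

    ∈-adjoin : ∀ {s x z} → z ∈ adjoin s x ⇔ (z ∈ s ⊎ z ≡ x)
    ∈-adjoin {s} {x} {z} = mk⇔ f g
      where
      f : z ∈ adjoin s x → z ∈ s ⊎ z ≡ x
      f p with to ∈-∪ p
      ... | inj₁ q = inj₁ q
      ... | inj₂ q = inj₂ ([ id , id ]′ (to ∈-double q))
      g : z ∈ s ⊎ z ≡ x → z ∈ adjoin s x
      g (inj₁ p) = from ∈-∪ (inj₁ p)
      g (inj₂ e) = from ∈-∪ (inj₂ (from ∈-double (inj₁ e)))

  -- Here and in the similar lemmas below, the indices 0, 1, 2 are no restriction: variables are
  -- only looked up, so other indices in a concrete environment reduce to the same proposition.
  adjoin-Sat : ∀ {t s x} → ⟦ adjoin′ 0F 1F 2F ⟧ (t ∷ s ∷ x ∷ []) ⇔ t ≡ adjoin s x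
  adjoin-Sat {t} {s} {x} = mk⇔ f g
    where
    f : ⟦ adjoin′ 0F 1F 2F ⟧ (t ∷ s ∷ x ∷ []) → t ≡ adjoin s x
    f (p , q , r) = ext
      (λ z z∈t → from ∈-adjoin ([ inj₁ , inj₂ ∘ lower ]′ (r z z∈t)))
      (λ z → [ p z , (λ { refl → q }) ]′ ∘ to ∈-adjoin)
    g : t ≡ adjoin s x → ⟦ adjoin′ 0F 1F 2F ⟧ (t ∷ s ∷ x ∷ [])
    g refl = (λ z → from ∈-adjoin ∘ inj₁) , from ∈-adjoin (inj₂ refl) ,
             (λ z → [ inj₁ , inj₂ ∘ lift ]′ ∘ to ∈-adjoin)

  -- Kuratowski's pair with ∅ as an additional element, which makes pairs
  -- recognisable among the sets to which they will be added as labels.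

  opaque
    pair : V → V → V
    pair x y = adjoin (double (double x x) (double x y)) ∅

    ∈-pair : ∀ {x y z} → z ∈ pair x y ⇔ (z ≡ ∅ ⊎ z ≡ double x x ⊎ z ≡ double x y)
    ∈-pair {x} {y} {z} = mk⇔ f g
      where
      f : z ∈ pair x y → z ≡ ∅ ⊎ z ≡ double x x ⊎ z ≡ double x y
      f p with to ∈-adjoin p
      ... | inj₁ q = inj₂ (to ∈-double q)
      ... | inj₂ e = inj₁ e
      g : z ≡ ∅ ⊎ z ≡ double x x ⊎ z ≡ double x y → z ∈ pair x y
      g (inj₁ e) = from ∈-adjoin (inj₂ e)
      g (inj₂ p) = from ∈-adjoin (inj₁ (from ∈-double p))

  double-Sat : ∀ {u x y} → ⟦ double′ 0F 1F 2F ⟧ (u ∷ x ∷ y ∷ []) ⇔ u ≡ double x y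
  double-Sat {u} {x} {y} = mk⇔ f g
    where
    f : ⟦ double′ 0F 1F 2F ⟧ (u ∷ x ∷ y ∷ []) → u ≡ double x y
    f (p , q , r) = ext
      (λ z z∈u → from ∈-double ([ inj₁ ∘ lower , inj₂ ∘ lower ]′ (r z z∈u)))
      (λ z → [ (λ { refl → p }) , (λ { refl → q }) ]′ ∘ to ∈-double)
    g : u ≡ double x y → ⟦ double′ 0F 1F 2F ⟧ (u ∷ x ∷ y ∷ [])
    g refl = from ∈-double (inj₁ refl) , from ∈-double (inj₂ refl) ,
             (λ z → [ inj₁ ∘ lift , inj₂ ∘ lift ]′ ∘ to ∈-double)

  empty-Sat : ∀ {x} → ⟦ empty′ 0F ⟧ (x ∷ []) ⇔ x ≡ ∅
  empty-Sat = mk⇔ (λ h → ext (λ z → ⊥-elim ∘ lower ∘ h z) (λ z → ⊥-elim ∘ ∉∅))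
                  (λ { refl z p → ⊥-elim (∉∅ p) })

  pair-Sat : ∀ {p x y} → ⟦ pair′ 0F 1F 2F ⟧ (p ∷ x ∷ y ∷ []) ⇔ p ≡ pair x y
  pair-Sat {p} {x} {y} = mk⇔ f g
    where
    f : ⟦ pair′ 0F 1F 2F ⟧ (p ∷ x ∷ y ∷ []) → p ≡ pair x y
    f ((u , u∈ , eu) , (v , v∈ , ev) , (w , w∈ , ew) , h) = ext
      (λ z z∈p → from ∈-pair
        ([ inj₁ ∘ to empty-Sat
         , inj₂ ∘ [ inj₁ ∘ to double-Sat , inj₂ ∘ to double-Sat ]′ ]′ (h z z∈p)))
      (λ z → [ (λ { refl → subst (_∈ p) (to empty-Sat eu) u∈ })
             , [ (λ { refl → subst (_∈ p) (to double-Sat ev) v∈ })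
               , (λ { refl → subst (_∈ p) (to double-Sat ew) w∈ }) ]′ ]′ ∘ to ∈-pair)
    g : p ≡ pair x y → ⟦ pair′ 0F 1F 2F ⟧ (p ∷ x ∷ y ∷ [])
    g refl =
      (_ , from ∈-pair (inj₁ refl) , from empty-Sat refl) ,
      (_ , from ∈-pair (inj₂ (inj₁ refl)) , from double-Sat refl) ,
      (_ , from ∈-pair (inj₂ (inj₂ refl)) , from double-Sat refl) ,
      (λ z → [ inj₁ ∘ from empty-Sat
             , inj₂ ∘ [ inj₁ ∘ from double-Sat , inj₂ ∘ from double-Sat ]′ ]′ ∘ to ∈-pair)

  double-nonempty : ∀ {x y} → double x y ≢ ∅
  double-nonempty {x} e = ∉∅ (subst (x ∈_) e (from ∈-double (inj₁ refl)))

  ∈-singleton : ∀ {x z} → z ∈ double x x → z ≡ x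
  ∈-singleton = [ id , id ]′ ∘ to ∈-double

  ∅∈pair : ∀ {x y} → ∅ ∈ pair x y
  ∅∈pair = from ∈-pair (inj₁ refl)

  -- The additional element ∅ does no harm: {x} is nonempty, so it must be {x′} or {x′, y′}, and in
  -- both cases x′ ∈ {x}.
  pair-injectiveˡ : ∀ {x y x′ y′} → pair x y ≡ pair x′ y′ → x ≡ x′
  pair-injectiveˡ {x} {x′ = x′} e
    with to ∈-pair (subst (double x x ∈_) e (from ∈-pair (inj₂ (inj₁ refl))))
  ... | inj₁ q        = ⊥-elim (double-nonempty q)
  ... | inj₂ (inj₁ q) = sym (∈-singleton (subst (x′ ∈_) (sym q) (from ∈-double (inj₁ refl))))
  ... | inj₂ (inj₂ q) = sym (∈-singleton (subst (x′ ∈_) (sym q) (from ∈-double (inj₁ refl))))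

  pair-injectiveʳ : ∀ {x y y′} → pair x y ≡ pair x y′ → y ≡ y′
  pair-injectiveʳ {x} {y} {y′} e = conclude (second e) (second (sym e))
    where
    second : ∀ {y y′} → pair x y ≡ pair x y′ → y ≡ x ⊎ y ≡ y′
    second {y} e with to ∈-pair (subst (double x y ∈_) e (from ∈-pair (inj₂ (inj₂ refl))))
    ... | inj₁ q        = ⊥-elim (double-nonempty q)
    ... | inj₂ (inj₁ q) = inj₁ (∈-singleton (subst (y ∈_) q (from ∈-double (inj₂ refl))))
    ... | inj₂ (inj₂ q) = to ∈-double (subst (y ∈_) q (from ∈-double (inj₂ refl)))
    conclude : y ≡ x ⊎ y ≡ y′ → y′ ≡ x ⊎ y′ ≡ y → y ≡ y′
    conclude (inj₂ p) _        = p
    conclude (inj₁ p) (inj₁ q) = trans p (sym q)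
    conclude (inj₁ p) (inj₂ q) = sym q

  pair-injective : ∀ {x y x′ y′} → pair x y ≡ pair x′ y′ → x ≡ x′ × y ≡ y′
  pair-injective e with refl ← pair-injectiveˡ e = refl , pair-injectiveʳ e

  -- Ordinals

  Transitive Ordinal : V → Set (a ⊔ b)
  Transitive x = ⟦ transitive′ 0F ⟧ (x ∷ [])
  Ordinal x = ⟦ ordinal′ 0F ⟧ (x ∷ [])

  ordinal⇔ : ∀ {x} → Ordinal x ⇔ IsOrdinal M x
  ordinal⇔ = mk⇔
    (λ (t , h) → (λ y z p q → lower (t y (lift p) z (lift q))) ,
                 (λ y p z w q r → lower (h y (lift p) z (lift q) w (lift r))))
    (λ (t , h) → (λ y p z q → lift (t y z (lower p) (lower q))) ,
                 (λ y p z q w r → lift (h y (lower p) z w (lower q) (lower r))))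

  ∈-ordinal : ∀ {x y} → Ordinal x → y ∈ x → Ordinal y
  ∈-ordinal {x} {y} (t , h) y∈x = h y y∈x , λ z z∈y → h z (t y y∈x z z∈y)

  ∅-ordinal : Ordinal ∅
  ∅-ordinal = (λ y → ⊥-elim ∘ ∉∅) , (λ y → ⊥-elim ∘ ∉∅)

  suc-ordinal : ∀ {x} → Ordinal x → Ordinal (adjoin x x)
  suc-ordinal {x} (t , h) =
    (λ y → [ (λ p z q → from ∈-adjoin (inj₁ (t y p z q)))
           , (λ { refl z q → from ∈-adjoin (inj₁ q) }) ]′ ∘ to ∈-adjoin) ,
    (λ y → [ h y , (λ { refl → t }) ]′ ∘ to ∈-adjoin)

  -- The bound A ∪ ⋃ A is the union of the successors x ∪ {x} for x ∈ A.
  ordinal-bound : ∀ A → (∀ x → x ∈ A → Ordinal x) →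
                  ∃[ s ] (Ordinal s × (∀ x → x ∈ A → x ∈ s))
  ordinal-bound A h = A ∪ ⋃ A , (tr , el) , λ x → from ∈-∪ ∘ inj₁
    where
    tr : Transitive (A ∪ ⋃ A)
    tr y y∈ z z∈y with to ∈-∪ y∈
    ... | inj₁ p = from ∈-∪ (inj₂ (from ∈-⋃ (y , p , z∈y)))
    ... | inj₂ p =
      let (w , w∈A , y∈w) = to ∈-⋃ p in
      from ∈-∪ (inj₂ (from ∈-⋃ (w , w∈A , proj₁ (h w w∈A) y y∈w z z∈y)))
    el : ∀ y → y ∈ A ∪ ⋃ A → Transitive y
    el y y∈ with to ∈-∪ y∈
    ... | inj₁ p = proj₁ (h y p)
    ... | inj₂ p = let (w , w∈A , y∈w) = to ∈-⋃ p in proj₂ (h w w∈A) y y∈w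

  -- Induction on x and, for fixed x, on y. If neither belongs to the other, the induction
  -- hypotheses and transitivity make each a subset of the other.
  compare : ∀ x y → Ordinal x → Ordinal y → x ∈ y ⊎ x ≡ y ⊎ y ∈ x
  compare x y p q = [ inj₁ , inj₂ ∘ [ inj₁ ∘ lower , inj₂ ]′ ]′ (outer x p y q)
    where
    C : Fin n → Fin n → Formula n
    C x y = x ∈′ y ∨′ x ≐ y ∨′ y ∈′ x

    outer : ∀ x → ⟦ ordinal′ 0F ⇒′ ∀′ (ordinal′ 0F ⇒′ C 1F 0F) ⟧ (x ∷ [])
    outer = ∈-ind (ordinal′ 0F ⇒′ ∀′ (ordinal′ 0F ⇒′ C 1F 0F)) [] λ x ihx ox →
      ∈-ind (ordinal′ 0F ⇒′ C 1F 0F) (x ∷ []) λ y ihy oy →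
        case x y ox oy (λ x′ x′∈x → ihx x′ x′∈x (∈-ordinal ox x′∈x) y oy)
                       (λ y′ y′∈y → ihy y′ y′∈y (∈-ordinal oy y′∈y))
      where
      case : ∀ x y → Ordinal x → Ordinal y →
             (∀ z → z ∈ x → ⟦ C 0F 1F ⟧ (z ∷ y ∷ [])) →
             (∀ z → z ∈ y → ⟦ C 0F 1F ⟧ (x ∷ z ∷ [])) → ⟦ C 0F 1F ⟧ (x ∷ y ∷ [])
      case x y ox oy hx hy with em {P = x ∈ y} | em {P = y ∈ x}
      ... | yes p | _     = inj₁ p
      ... | no _  | yes q = inj₂ (inj₂ q)
      ... | no ¬p | no ¬q = inj₂ (inj₁ (lift (ext x⊆y y⊆x)))
        where
        x⊆y : ∀ z → z ∈ x → z ∈ y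
        x⊆y z z∈x with hx z z∈x
        ... | inj₁ r                = r
        ... | inj₂ (inj₁ (lift refl)) = ⊥-elim (¬q z∈x)
        ... | inj₂ (inj₂ r)         = ⊥-elim (¬q (proj₁ ox z z∈x y r))
        y⊆x : ∀ z → z ∈ y → z ∈ x
        y⊆x z z∈y with hy z z∈y
        ... | inj₁ r                = ⊥-elim (¬p (proj₁ oy z z∈y x r))
        ... | inj₂ (inj₁ (lift refl)) = ⊥-elim (¬p z∈y)
        ... | inj₂ (inj₂ r)         = r

  -- Ranks

  has-pair-Sat : ∀ {g x y} → ⟦ has-pair′ 0F 1F 2F ⟧ (g ∷ x ∷ y ∷ []) ⇔ pair x y ∈ g
  has-pair-Sat {g} = mk⇔ (λ (p , p∈g , e) → subst (_∈ g) (to pair-Sat e) p∈g)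
                         (λ p∈g → _ , p∈g , from pair-Sat refl)

  Ranking : V → Set (a ⊔ b)
  Ranking g = ⟦ ranking′ 0F ⟧ (g ∷ [])

  Ranks : V → V → V → Set (a ⊔ b)
  Ranks g γ y = Ordinal γ × (∀ z → z ∈ y → ∃[ δ ] (δ ∈ γ × pair z δ ∈ g))

  ranking-elim : ∀ {g y γ} → Ranking g → pair y γ ∈ g → Ranks g γ y
  ranking-elim {g} {y} {γ} r p =
    -- The quantifiers of `ranking′` are bounded, so y and γ are reached through the element {y, γ}
    -- of the pair.
    let (o , h) = r (pair y γ) p (double y γ) (from ∈-pair (inj₂ (inj₂ refl)))
                    y (from ∈-double (inj₁ refl)) γ (from ∈-double (inj₂ refl))
                    (from pair-Sat refl)
    in o , λ z z∈y → let (δ , δ∈γ , q) = h z z∈y in δ , δ∈γ , to has-pair-Sat q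

  ranking-intro : ∀ {g} → (∀ y γ → pair y γ ∈ g → Ranks g γ y) → Ranking g
  ranking-intro {g} r p p∈g u _ y _ γ _ e =
    let (o , h) = r y γ (subst (_∈ g) (to pair-Sat e) p∈g)
    in o , λ z z∈y → let (δ , δ∈γ , q) = h z z∈y in δ , δ∈γ , from has-pair-Sat q

  ⋃-ranking : ∀ w → (∀ g → g ∈ w → Ranking g) → Ranking (⋃ w)
  ⋃-ranking w h = ranking-intro λ y γ p →
    let (g , g∈w , p∈g) = to ∈-⋃ p
        (o , k) = ranking-elim (h g g∈w) p∈g
    in o , λ z z∈y → let (δ , δ∈γ , q) = k z z∈y in δ , δ∈γ , from ∈-⋃ (g , g∈w , q)

  -- Such a γ is only an upper bound for the rank of x; the rank will be the least one.
  RankedBy : V → V → Set (a ⊔ b)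
  RankedBy γ x = ∃[ g ] (Ranking g × pair x γ ∈ g)

  rankedBy′ : Fin n → Fin n → Formula n
  rankedBy′ γ x = ∃′ (ranking′ 0F ∧′ has-pair′ 0F (suc x) (suc γ))

  rankedBy-Sat : ∀ {γ x} → ⟦ rankedBy′ 0F 1F ⟧ (γ ∷ x ∷ []) ⇔ RankedBy γ x
  rankedBy-Sat = mk⇔ (λ (g , r , p) → g , r , to has-pair-Sat p)
                     (λ (g , r , p) → g , r , from has-pair-Sat p)

  opaque
    -- No ranking has to be chosen for each y: collection gives a set of rankings, and its union is
    -- a ranking.
    common-ranking : ∀ x → (∀ y → y ∈ x → ∃[ γ ] RankedBy γ y) →
                     ∃[ g ] (Ranking g × (∀ y → y ∈ x → ∃[ γ ] (pair y γ ∈ g)))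
    common-ranking x h = ⋃ w , ⋃-ranking w sound , covers
      where
      φ : Formula 2
      -- To keep the formula Δ₀, γ is sought inside an element of a pair in g.
      φ = ranking′ 0F ∧′ ∃∈ 0F (∃∈ 0F (∃∈ 0F (pair′ 2F 4F 0F)))
      coll : ∃[ w ] ((∀ g → g ∈ w → ∃[ y ] (y ∈ x × ⟦ φ ⟧ (g ∷ y ∷ []))) ×
                     (∀ y → y ∈ x → ∃[ g ] (g ∈ w × ⟦ φ ⟧ (g ∷ y ∷ []))))
      coll = collection (Δ₀! φ) [] x λ y y∈x →
        let (γ , g , r , p) = h y y∈x in
        g , r , pair y γ , p , double y γ , from ∈-pair (inj₂ (inj₂ refl)) ,
        γ , from ∈-double (inj₂ refl) , from pair-Sat refl
      w : V
      w = proj₁ coll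
      sound : ∀ g → g ∈ w → Ranking g
      sound g g∈w = let (_ , _ , r , _) = proj₁ (proj₂ coll) g g∈w in r
      covers : ∀ y → y ∈ x → ∃[ γ ] (pair y γ ∈ ⋃ w)
      covers y y∈x =
        let (g , g∈w , _ , p , p∈g , _ , _ , γ , _ , e) = proj₂ (proj₂ coll) y y∈x in
        γ , from ∈-⋃ (g , g∈w , subst (_∈ g) (to pair-Sat e) p∈g)

    ranking-bound : ∀ x g → Ranking g → (∀ y → y ∈ x → ∃[ γ ] (pair y γ ∈ g)) →
      ∃[ s ] (Ordinal s × (∀ y → y ∈ x → ∃[ γ ] (γ ∈ s × pair y γ ∈ g)))
    ranking-bound x g r h =
      let (w , sound , complete) = collection (Δ₀! (has-pair′ 2F 1F 0F)) (g ∷ []) x λ y y∈x →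
            let (γ , p) = h y y∈x in γ , from has-pair-Sat p
          (s , os , A⊆s) = ordinal-bound w λ γ γ∈w →
            let (y , _ , p) = sound γ γ∈w in proj₁ (ranking-elim r (to has-pair-Sat p))
      in s , os , λ y y∈x →
         let (γ , γ∈w , p) = complete y y∈x in γ , A⊆s γ γ∈w , to has-pair-Sat p

  -- The pair (x, s) may be added whatever g already assigns to x, as rankings need not be
  -- functions.
  ranked-step : ∀ x → (∀ y → y ∈ x → ∃[ γ ] RankedBy γ y) → ∃[ γ ] RankedBy γ x
  ranked-step x ih with common-ranking x ih
  ... | g , r , covers with ranking-bound x g r covers
  ... | s , os , h =
    s , g′ , ranking-intro (λ y γ → [ old , new ]′ ∘ to ∈-adjoin) , from ∈-adjoin (inj₂ refl)
    where
    g′ : V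
    g′ = adjoin g (pair x s)
    old : ∀ {y γ} → pair y γ ∈ g → Ranks g′ γ y
    old p = let (o , k) = ranking-elim r p in
      o , λ z z∈y → let (δ , δ∈γ , q) = k z z∈y in δ , δ∈γ , from ∈-adjoin (inj₁ q)
    new : ∀ {y γ} → pair y γ ≡ pair x s → Ranks g′ γ y
    new e with refl , refl ← pair-injective e = os , λ z z∈x →
      let (δ , δ∈s , q) = h z z∈x in δ , δ∈s , from ∈-adjoin (inj₁ q)

  opaque
    ranked : ∀ x → ∃[ γ ] RankedBy γ x
    ranked x = let (γ , r) = ∈-ind (∃′ (rankedBy′ 0F 1F)) [] (λ x ih →
                     let (γ , r) = ranked-step x λ y y∈x →
                           let (δ , q) = ih y y∈x in δ , to rankedBy-Sat q
                     in γ , from rankedBy-Sat r) x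
               in γ , to rankedBy-Sat r

  rankedBy-ordinal : ∀ {γ x} → RankedBy γ x → Ordinal γ
  rankedBy-ordinal (g , r , p) = proj₁ (ranking-elim r p)

  opaque
    least-rank : ∀ x → ∃[ γ ] (RankedBy γ x × (∀ δ → δ ∈ γ → ¬ RankedBy δ x))
    least-rank x =
      let (γ , r) = ranked x
          (δ , q , h) = ∈-min (rankedBy′ 0F 1F) (x ∷ []) γ (from rankedBy-Sat r)
      in δ , to rankedBy-Sat q , λ ε ε∈δ → h ε ε∈δ ∘ from rankedBy-Sat

  rank : V → V
  rank x = proj₁ (least-rank x)

  rank-ordinal : ∀ x → Ordinal (rank x)
  rank-ordinal x = rankedBy-ordinal (proj₁ (proj₂ (least-rank x)))

  -- A ranking that assigns `rank x` to x assigns some δ ∈ `rank x` to y. If `rank y` were not below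
  -- `rank x`, then δ ∈ `rank y`, against the minimality of `rank y`.
  rank-mono : ∀ {x y} → y ∈ x → rank y ∈ rank x
  rank-mono {x} {y} y∈x with compare (rank y) (rank x) (rank-ordinal y) (rank-ordinal x)
  ... | inj₁ p = p
  ... | inj₂ h =
    let (g , r , p) = proj₁ (proj₂ (least-rank x))
        (δ , δ∈ , q) = proj₂ (ranking-elim r p) y y∈x
    in ⊥-elim (proj₂ (proj₂ (least-rank y)) δ
         ([ (λ e → subst (δ ∈_) (sym e) δ∈)
          , (λ e → proj₁ (rank-ordinal y) (rank x) e δ δ∈) ]′ h) (g , r , q))

  -- The sets v(β,l)

  infix 4 _~_
  _~_ : V → V → Set (a ⊔ b)
  k ~ l = ⟦ linked′ 0F 1F ⟧ (k ∷ l ∷ [])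

  module _ (K : V) where

    Predecessor : V → V → V → Set (a ⊔ b)
    Predecessor z β l = ∃[ α ] (α ∈ β × ∃[ k ] (k ∈ K × k ~ l × pair α k ∈ z))

    record Node (y β l T : V) : Set (a ⊔ b) where
      constructor node
      field
        label    : pair β l ∈ y
        elements : ∀ z → z ∈ y → z ≡ pair β l ⊎ (z ∈ T × Predecessor z β l)
        complete : ∀ α → α ∈ β → ∀ k → k ∈ K → k ~ l → ∃[ z ] (z ∈ y × z ∈ T × pair α k ∈ z)

    open Node

    opaque
      predecessor-Sat : ∀ {z β l} →
        ⟦ predecessor′ 0F 1F 2F 3F ⟧ (z ∷ β ∷ l ∷ K ∷ []) ⇔ Predecessor z β l
      predecessor-Sat = mk⇔
        (λ (α , α∈β , k , k∈K , r , p) → α , α∈β , k , k∈K , r , to has-pair-Sat p)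
        (λ (α , α∈β , k , k∈K , r , p) → α , α∈β , k , k∈K , r , from has-pair-Sat p)

      node-Sat : ∀ {y β l T} → ⟦ node′ 0F 1F 2F 3F 4F ⟧ (y ∷ β ∷ l ∷ T ∷ K ∷ []) ⇔ Node y β l T
      node-Sat {y} {β} {l} {T} = mk⇔ f g
        where
        f : ⟦ node′ 0F 1F 2F 3F 4F ⟧ (y ∷ β ∷ l ∷ T ∷ K ∷ []) → Node y β l T
        f (p , q , r) = node (to has-pair-Sat p)
          (λ z z∈y → [ inj₁ ∘ to pair-Sat
                     , (λ (t , s) → inj₂ (t , to predecessor-Sat s)) ]′ (q z z∈y))
          (λ α α∈β k k∈K h → let (z , z∈y , z∈T , s) = r α α∈β k k∈K h in
                             z , z∈y , z∈T , to has-pair-Sat s)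
        g : Node y β l T → ⟦ node′ 0F 1F 2F 3F 4F ⟧ (y ∷ β ∷ l ∷ T ∷ K ∷ [])
        g (node p q r) = from has-pair-Sat p ,
          (λ z z∈y → [ inj₁ ∘ from pair-Sat
                     , (λ (t , s) → inj₂ (t , from predecessor-Sat s)) ]′ (q z z∈y)) ,
          (λ α α∈β k k∈K h → let (z , z∈y , z∈T , s) = r α α∈β k k∈K h in
                             z , z∈y , z∈T , from has-pair-Sat s)

    Closed : V → Set (a ⊔ b)
    Closed T = ∀ y → y ∈ T → ∃[ β ] ∃[ l ] Node y β l T

    Stage : V → V → Set (a ⊔ b)
    Stage T β = Closed T × (∀ l → l ∈ K → ∃[ y ] (y ∈ T × pair β l ∈ y))

    opaque
      closed-Sat : ∀ {T} → ⟦ closed′ 0F 1F ⟧ (T ∷ K ∷ []) ⇔ Closed T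
      closed-Sat {T} = mk⇔ f g
        where
        f : ⟦ closed′ 0F 1F ⟧ (T ∷ K ∷ []) → Closed T
        f h y y∈T = let (_ , _ , _ , _ , β , _ , l , _ , p) = h y y∈T in β , l , to node-Sat p
        g : Closed T → ⟦ closed′ 0F 1F ⟧ (T ∷ K ∷ [])
        g h y y∈T = let (β , l , p) = h y y∈T in
          pair β l , label p , double β l , from ∈-pair (inj₂ (inj₂ refl)) ,
          β , from ∈-double (inj₁ refl) , l , from ∈-double (inj₂ refl) , from node-Sat p

      stage-Sat : ∀ {T β} → ⟦ stage′ 0F 1F 2F ⟧ (T ∷ β ∷ K ∷ []) ⇔ Stage T β
      stage-Sat {T} {β} = mk⇔ f g
        where
        f : ⟦ stage′ 0F 1F 2F ⟧ (T ∷ β ∷ K ∷ []) → Stage T β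
        f (c , h) = to closed-Sat c , λ l l∈K →
          let (y , y∈T , p) = h l l∈K in y , y∈T , to has-pair-Sat p
        g : Stage T β → ⟦ stage′ 0F 1F 2F ⟧ (T ∷ β ∷ K ∷ [])
        g (c , h) = from closed-Sat c , λ l l∈K →
          let (y , y∈T , p) = h l l∈K in y , y∈T , from has-pair-Sat p

    Node-mono : ∀ {y β l T T′} → (∀ z → z ∈ T → z ∈ T′) → Node y β l T → Node y β l T′
    Node-mono h (node p q r) = node p
      (λ z z∈y → [ inj₁ , (λ (t , s) → inj₂ (h z t , s)) ]′ (q z z∈y))
      (λ α α∈β k k∈K e → let (z , z∈y , z∈T , s) = r α α∈β k k∈K e in z , z∈y , h z z∈T , s)

    Closed-mono : ∀ {T T′} → (∀ z → z ∈ T → z ∈ T′) → Closed T →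
                  ∀ y → y ∈ T → ∃[ β ] ∃[ l ] Node y β l T′
    Closed-mono h c y y∈T = let (β , l , p) = c y y∈T in β , l , Node-mono h p

    opaque
      common-stage : ∀ β → (∀ α → α ∈ β → ∃[ T ] Stage T α) →
                     ∃[ T ] (Closed T ×
                       (∀ α → α ∈ β → ∀ k → k ∈ K → ∃[ y ] (y ∈ T × pair α k ∈ y)))
      common-stage β h =
        let (w , sound , complete) = collection (Δ₀! (stage′ 0F 1F 2F)) (K ∷ []) β λ α α∈β →
              let (T , s) = h α α∈β in T , from stage-Sat s
        in ⋃ w ,
           (λ y y∈ → let (T , T∈w , y∈T) = to ∈-⋃ y∈
                         (_ , _ , s) = sound T T∈w
                     in Closed-mono (λ z z∈T → from ∈-⋃ (T , T∈w , z∈T))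
                                    (proj₁ (to stage-Sat s)) y y∈T) ,
           (λ α α∈β k k∈K → let (T , T∈w , s) = complete α α∈β
                                (y , y∈T , p) = proj₂ (to stage-Sat s) k k∈K
                            in y , from ∈-⋃ (T , T∈w , y∈T) , p)

      -- T already contains all v(α,k) with α ∈ β, so each v(β,l) is separated from T up to its
      -- label; collection over l ∈ K gathers the results.
      next-nodes : ∀ β T → (∀ α → α ∈ β → ∀ k → k ∈ K → ∃[ y ] (y ∈ T × pair α k ∈ y)) →
        ∃[ w ] ((∀ y → y ∈ w → ∃[ l ] Node y β l T) ×
                (∀ l → l ∈ K → ∃[ y ] (y ∈ w × pair β l ∈ y)))
      next-nodes β T h =
        let (w , sound , complete) = collection (Δ₀! (node′ 0F 2F 1F 3F 4F)) (β ∷ T ∷ K ∷ []) K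
              λ l _ → new l , from node-Sat (new-node l)
        in w , (λ y y∈w → let (l , _ , p) = sound y y∈w in l , to node-Sat p)
             , (λ l l∈K → let (y , y∈w , p) = complete l l∈K in y , y∈w , label (to node-Sat p))
        where
        preds new : V → V
        preds l = sep (Δ₀! (predecessor′ 0F 1F 2F 3F)) (β ∷ l ∷ K ∷ []) T
        new l = adjoin (preds l) (pair β l)

        ∈-preds : ∀ l z → z ∈ preds l ⇔ (z ∈ T × ⟦ predecessor′ 0F 1F 2F 3F ⟧ (z ∷ β ∷ l ∷ K ∷ []))
        ∈-preds l z = ∈-sep (Δ₀! (predecessor′ 0F 1F 2F 3F)) (β ∷ l ∷ K ∷ []) T z

        new-node : ∀ l → Node (new l) β l T
        new-node l = node (from ∈-adjoin (inj₂ refl))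
          (λ z z∈ → [ (λ p → let (t , s) = to (∈-preds l z) p in inj₂ (t , to predecessor-Sat s))
                    , inj₁ ]′ (to ∈-adjoin z∈))
          (λ α α∈β k k∈K r → let (z , z∈T , p) = h α α∈β k k∈K in
             z , from ∈-adjoin (inj₁ (from (∈-preds l z)
                   (z∈T , from predecessor-Sat (α , α∈β , k , k∈K , r , p)))) , z∈T , p)

    stage-step : ∀ β → (∀ α → α ∈ β → ∃[ T ] Stage T α) → ∃[ T ] Stage T β
    stage-step β ih =
      let (T , closed , covers) = common-stage β ih
          (w , sound , complete) = next-nodes β T covers
          incl = λ z → from (∈-∪ {T} {w}) ∘ inj₁ {A = z ∈ T}
      in T ∪ w ,
         (λ y → [ Closed-mono incl closed y
                , (λ y∈w → let (l , p) = sound y y∈w in β , l , Node-mono incl p) ]′ ∘ to ∈-∪) ,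
         (λ l l∈K → let (y , y∈w , p) = complete l l∈K in y , from ∈-∪ (inj₂ y∈w) , p)

    opaque
      stage : ∀ β → ∃[ T ] Stage T β
      stage β = let (T , s) = ∈-ind (∃′ (stage′ 0F 1F 2F)) (K ∷ []) step β in T , to stage-Sat s
        where
        step : ∀ β → (∀ α → α ∈ β → ∃[ T ] ⟦ stage′ 0F 1F 2F ⟧ (T ∷ α ∷ K ∷ [])) →
               ∃[ T ] ⟦ stage′ 0F 1F 2F ⟧ (T ∷ β ∷ K ∷ [])
        step β ih =
          let (T , s) = stage-step β λ α α∈β → let (T , s) = ih α α∈β in T , to stage-Sat s
          in T , from stage-Sat s

    -- Every element of a node is nonempty: it is a label, or it contains one. As every pair
    -- contains ∅, labels and nodes cannot be confused.
    ∅∉Node : ∀ {y β l T} → Node y β l T → ∅ ∉ y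
    ∅∉Node {T = T} p ∅∈y with elements p ∅ ∅∈y
    ... | inj₁ e                              = ∉∅ (subst (∅ ∈_) (sym e) ∅∈pair)
    ... | inj₂ (_ , _ , _ , _ , _ , _ , q) = ∉∅ q

    -- A second pair in y would belong to T and hence be a node, although it contains ∅.
    label-unique : ∀ {y β l T β′ l′} → Closed T → Node y β l T → pair β′ l′ ∈ y → β′ ≡ β × l′ ≡ l
    label-unique c p q with elements p _ q
    ... | inj₁ e         = pair-injective e
    ... | inj₂ (q∈T , _) = let (_ , _ , r) = c _ q∈T in ⊥-elim (∅∉Node r ∅∈pair)

    Node-of : ∀ {y β l T} → Closed T → y ∈ T → pair β l ∈ y → Node y β l T
    Node-of {y} {β} {l} {T} c y∈T q with c y y∈T
    ... | _ , _ , p with refl , refl ← label-unique c p q = p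

    -- Two closed sets are involved because vertices with different labels come from different
    -- stages.
    UniqueNode : V → Set (a ⊔ b)
    UniqueNode β = ∀ {T T′ y y′ l} → Closed T → Closed T′ → y ∈ T → y′ ∈ T′ →
                   pair β l ∈ y → pair β l ∈ y′ → y ≡ y′

    Node-⊆ : ∀ {T T′ y y′ β l} → (∀ α → α ∈ β → UniqueNode α) → Closed T → Closed T′ →
             Node y β l T → Node y′ β l T′ → ∀ z → z ∈ y → z ∈ y′
    Node-⊆ {y′ = y′} ih c c′ p p′ z z∈y with elements p z z∈y
    ... | inj₁ e = subst (_∈ y′) (sym e) (label p′)
    ... | inj₂ (z∈T , α , α∈β , k , k∈K , r , q) =
      let (z′ , z′∈y′ , z′∈T′ , q′) = complete p′ α α∈β k k∈K r
      in subst (_∈ y′) (sym (ih α α∈β c c′ z∈T z′∈T′ q q′)) z′∈y′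

    opaque
      unique-node : ∀ β → UniqueNode β
      unique-node β = to (unique-Sat β)
        (∈-ind (unique-node′ 0F 1F) (K ∷ []) (λ β ih → from (unique-Sat β)
          (step β (λ α α∈β → to (unique-Sat α) (ih α α∈β)))) β)
        where
        unique-Sat : ∀ β → ⟦ unique-node′ 0F 1F ⟧ (β ∷ K ∷ []) ⇔ UniqueNode β
        unique-Sat β = mk⇔ f g
          where
          f : ⟦ unique-node′ 0F 1F ⟧ (β ∷ K ∷ []) → UniqueNode β
          f h {T} {T′} {y} {y′} {l} c c′ y∈T y′∈T′ p p′ = lower
            (h T T′ y y′ l (from closed-Sat c) (from closed-Sat c′) y∈T y′∈T′
               (from has-pair-Sat p) (from has-pair-Sat p′))
          g : UniqueNode β → ⟦ unique-node′ 0F 1F ⟧ (β ∷ K ∷ [])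
          g h T T′ y y′ l c c′ y∈T y′∈T′ p p′ = lift
            (h (to closed-Sat c) (to closed-Sat c′) y∈T y′∈T′
               (to has-pair-Sat p) (to has-pair-Sat p′))
        step : ∀ β → (∀ α → α ∈ β → UniqueNode α) → UniqueNode β
        step β ih c c′ y∈T y′∈T′ p p′ =
          let q = Node-of c y∈T p ; q′ = Node-of c′ y′∈T′ p′
          in ext (Node-⊆ ih c c′ q q′) (Node-⊆ ih c′ c q′ q)

    opaque
      vertex : (β l : V) → l ∈ K → V
      vertex β l l∈K = proj₁ (proj₂ (proj₂ (stage β)) l l∈K)

      vertex-node : ∀ β l (l∈K : l ∈ K) →
                    ∃[ T ] (Closed T × vertex β l l∈K ∈ T × Node (vertex β l l∈K) β l T)
      vertex-node β l l∈K =
        let (T , c , h) = stage β ; (_ , y∈T , p) = h l l∈K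
        in T , c , y∈T , Node-of c y∈T p

    -- Completeness yields an element of the second vertex labelled (α,k); by `unique-node` it is
    -- the first vertex.
    vertex-∈⁺ : ∀ {α β k l} {k∈K : k ∈ K} {l∈K : l ∈ K} →
                α ∈ β → k ~ l → vertex α k k∈K ∈ vertex β l l∈K
    vertex-∈⁺ {α} {β} {k} {l} {k∈K} {l∈K} α∈β r =
      let (T , c , y∈T , p) = vertex-node α k k∈K
          (T′ , c′ , _ , p′) = vertex-node β l l∈K
          (z , z∈y′ , z∈T′ , q) = complete p′ α α∈β k k∈K r
      in subst (_∈ vertex β l l∈K) (sym (unique-node α c c′ y∈T z∈T′ (label p) q)) z∈y′

    vertex-∈⁻ : ∀ {α β k l} {k∈K : k ∈ K} {l∈K : l ∈ K} →
                vertex α k k∈K ∈ vertex β l l∈K → α ∈ β × k ~ l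
    vertex-∈⁻ {α} {β} {k} {l} {k∈K} {l∈K} h with vertex-node α k k∈K | vertex-node β l l∈K
    ... | T , c , y∈T , p | T′ , c′ , _ , p′ with elements p′ _ h
    -- A vertex is not a label, since labels contain ∅.
    ... | inj₁ e = ⊥-elim (∅∉Node p (subst (∅ ∈_) (sym e) ∅∈pair))
    ... | inj₂ (_ , α′ , α′∈β , k′ , _ , r , q)
      with refl , refl ← label-unique c p q = α′∈β , r

    vertex-injective : ∀ {α β k l} {k∈K : k ∈ K} {l∈K : l ∈ K} →
                       vertex α k k∈K ≡ vertex β l l∈K → α ≡ β × k ≡ l
    vertex-injective {α} {β} {k} {l} {k∈K} {l∈K} e =
      let (T , c , y∈T , p) = vertex-node α k k∈K
          (T′ , c′ , _ , p′) = vertex-node β l l∈K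
      in label-unique c′ p′ (subst (_ ∈_) e (label p))

  -- Numerals and finite sets of numerals

  FiniteClosed : V → V → Set (a ⊔ b)
  FiniteClosed x K = ∅ ∈ K × (∀ s → s ∈ K → ∀ y → y ∈ x → adjoin s y ∈ K)

  opaque
    finite-closed-Sat : ∀ {K x} → ⟦ finite-closed′ 1F 0F ⟧ (K ∷ x ∷ []) ⇔ FiniteClosed x K
    finite-closed-Sat {K} {x} = mk⇔ f g
      where
      f : ⟦ finite-closed′ 1F 0F ⟧ (K ∷ x ∷ []) → FiniteClosed x K
      f ((e , e∈K , p) , h) = subst (_∈ K) (to empty-Sat p) e∈K , λ s s∈K y y∈x →
        let (t , t∈K , q) = h s s∈K y y∈x in subst (_∈ K) (to adjoin-Sat q) t∈K
      g : FiniteClosed x K → ⟦ finite-closed′ 1F 0F ⟧ (K ∷ x ∷ [])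
      g (p , h) = (∅ , p , from empty-Sat refl) , λ s s∈K y y∈x →
        adjoin s y , h s s∈K y y∈x , from adjoin-Sat refl

    adjoin-comm : ∀ {s x y} → adjoin (adjoin s x) y ≡ adjoin (adjoin s y) x
    adjoin-comm = ext half half
      where
      half : ∀ {s x y} z → z ∈ adjoin (adjoin s x) y → z ∈ adjoin (adjoin s y) x
      half z p with to ∈-adjoin p
      ... | inj₂ e = from ∈-adjoin (inj₁ (from ∈-adjoin (inj₂ e)))
      ... | inj₁ q with to ∈-adjoin q
      ... | inj₁ r = from ∈-adjoin (inj₁ (from ∈-adjoin (inj₁ r)))
      ... | inj₂ e = from ∈-adjoin (inj₂ e)

    adjoin-idem : ∀ {s x} → adjoin (adjoin s x) x ≡ adjoin s x
    adjoin-idem = ext (λ z → [ id , from ∈-adjoin ∘ inj₂ ]′ ∘ to ∈-adjoin)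
                      (λ z → from ∈-adjoin ∘ inj₁)

    finite-closed-∅ : ∃[ K ] FiniteClosed ∅ K
    finite-closed-∅ = adjoin ∅ ∅ , from ∈-adjoin (inj₂ refl) , λ s _ y y∈∅ → ⊥-elim (∉∅ y∈∅)

    -- The new set is K ∪ {s ∪ {y} : s ∈ K}; adjoining y twice has no effect, and adjunctions
    -- commute.
    finite-closed-adjoin : ∀ {x y} → ∃[ K ] FiniteClosed x K → ∃[ K ] FiniteClosed (adjoin x y) K
    finite-closed-adjoin {x} {y} (K , ∅∈K , h) =
      let (w , sound , complete) = collection (Δ₀! (adjoin′ 0F 1F 2F)) (y ∷ []) K
            λ s _ → adjoin s y , from adjoin-Sat refl
          in-w = λ s s∈K → let (t , t∈w , e) = complete s s∈K in subst (_∈ w) (to adjoin-Sat e) t∈w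
          from-w = λ t t∈w → let (s , s∈K , e) = sound t t∈w in s , s∈K , to adjoin-Sat e
      in K ∪ w , from ∈-∪ (inj₁ ∅∈K) , closed w in-w from-w
      where
      closed : ∀ w → (∀ s → s ∈ K → adjoin s y ∈ w) →
               (∀ t → t ∈ w → ∃[ s ] (s ∈ K × t ≡ adjoin s y)) →
               ∀ s → s ∈ K ∪ w → ∀ z → z ∈ adjoin x y → adjoin s z ∈ K ∪ w
      closed w in-w from-w s s∈ z z∈ with to ∈-∪ s∈ | to ∈-adjoin z∈
      ... | inj₁ s∈K | inj₁ z∈x  = from ∈-∪ (inj₁ (h s s∈K z z∈x))
      ... | inj₁ s∈K | inj₂ refl = from ∈-∪ (inj₂ (in-w s s∈K))
      ... | inj₂ s∈w | q with from-w s s∈w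
      closed w in-w from-w s s∈ z z∈ | inj₂ s∈w | inj₁ z∈x | r , r∈K , refl =
        from ∈-∪ (inj₂ (subst (_∈ w) adjoin-comm (in-w (adjoin r z) (h r r∈K z z∈x))))
      closed w in-w from-w s s∈ z z∈ | inj₂ s∈w | inj₂ refl | r , r∈K , refl =
        from ∈-∪ (inj₂ (subst (_∈ w) (sym adjoin-idem) s∈w))

  numeral : ℕ → V
  numeral zero    = ∅
  numeral (suc n) = adjoin (numeral n) (numeral n)

  numeral-ordinal : ∀ n → Ordinal (numeral n)
  numeral-ordinal zero    = ∅-ordinal
  numeral-ordinal (suc n) = suc-ordinal (numeral-ordinal n)

  -- The induction is external, so standard numerals have only standard elements even in an
  -- ill-founded model.
  ∈-numeral : ∀ n {z} → z ∈ numeral n → ∃[ i ] (i < n × z ≡ numeral i)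
  ∈-numeral zero    p = ⊥-elim (∉∅ p)
  ∈-numeral (suc n) p with to ∈-adjoin p
  ... | inj₁ q = let (i , i<n , e) = ∈-numeral n q in i , m<n⇒m<1+n i<n , e
  ... | inj₂ e = n , n<1+n n , e

  numeral-mono : ∀ {i n} → i < n → numeral i ∈ numeral n
  numeral-mono {n = suc n} i<1+n with m<1+n⇒m<n∨m≡n i<1+n
  ... | inj₁ i<n  = from ∈-adjoin (inj₁ (numeral-mono i<n))
  ... | inj₂ refl = from ∈-adjoin (inj₂ refl)

  numeral-injective : ∀ {i n} → numeral i ≡ numeral n → i ≡ n
  numeral-injective {i} {n} e with <-cmp i n
  ... | tri< i<n _ _ = ⊥-elim (∈-irrefl (subst (_∈ numeral n) e (numeral-mono i<n)))
  ... | tri≈ _ i≡n _ = i≡n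
  ... | tri> _ _ n<i = ⊥-elim (∈-irrefl (subst (numeral n ∈_) e (numeral-mono n<i)))

  numeral-reflect : ∀ {i n} → numeral i ∈ numeral n → i < n
  numeral-reflect {i} {n} p with ∈-numeral n p
  ... | j , j<n , e = subst (_< n) (sym (numeral-injective e)) j<n

  numeral-suc : ∀ n {x} → Ordinal x → numeral n ∈ x →
                numeral (suc n) ∈ x ⊎ numeral (suc n) ≡ x
  numeral-suc n {x} ox q with compare (numeral (suc n)) x (numeral-ordinal (suc n)) ox
  ... | inj₁ p        = inj₁ p
  ... | inj₂ (inj₁ e) = inj₂ e
  ... | inj₂ (inj₂ p) with to ∈-adjoin p
  ... | inj₁ r    = ⊥-elim (∈-irrefl (proj₁ (numeral-ordinal n) x r _ q))
  ... | inj₂ refl = ⊥-elim (∈-irrefl q)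

  -- True of infinite ordinals, but also of nonstandard natural numbers of the model.
  HasNumerals : V → Set (a ⊔ b)
  HasNumerals x = ∀ n → numeral n ∈ x

  opaque
    -- If some ordinal m has no K with FiniteClosed m K, the least such m is
    -- neither ∅ nor a successor, so it contains all numerals, and collection over
    -- its elements yields the required set.

    finite-subsets : ∀ x → Ordinal x → HasNumerals x →
      ∃[ K ] ∀ n → ∃[ L ] (FiniteClosed (numeral n) L × (∀ z → z ∈ L → z ∈ K))
    finite-subsets x ox h with em {P = ∃[ K ] FiniteClosed x K}
    ... | yes (K , p , q) =
      K , λ n → K , (p , λ s s∈K y y∈n → q s s∈K y (proj₁ ox (numeral n) (h n) y y∈n)) , λ z → id
    ... | no ¬K with ∈-min (ordinal′ 0F ∧′ (∃′ (finite-closed′ 1F 0F) ⇒′ ⊥′)) [] x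
                       (ox , λ (K , p) → ⊥-elim (¬K (K , to finite-closed-Sat p)))
    ... | m , (om , ¬m) , least =
      let (w , _ , complete) = collection (Δ₀! (finite-closed′ 1F 0F)) [] m λ y y∈m →
            let (K , p) = below y y∈m in K , from finite-closed-Sat p
      in ⋃ w , λ n → let (L , L∈w , p) = complete (numeral n) (numerals n) in
         L , to finite-closed-Sat p , λ z z∈L → from ∈-⋃ (L , L∈w , z∈L)
      where
      not-m : ∀ {y} → ∃[ K ] FiniteClosed y K → y ≢ m
      not-m (K , p) refl = lower (¬m (K , from finite-closed-Sat p))
      below : ∀ y → y ∈ m → ∃[ K ] FiniteClosed y K
      below y y∈m with em {P = ∃[ K ] FiniteClosed y K}
      ... | yes p = p
      ... | no ¬p = ⊥-elim (least y y∈m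
        (∈-ordinal om y∈m , λ (K , p) → ⊥-elim (¬p (K , to finite-closed-Sat p))))
      numerals : ∀ n → numeral n ∈ m
      numerals zero with compare ∅ m ∅-ordinal om
      ... | inj₁ p        = p
      ... | inj₂ (inj₁ e) = ⊥-elim (not-m finite-closed-∅ e)
      ... | inj₂ (inj₂ p) = ⊥-elim (∉∅ p)
      numerals (suc n) with numeral-suc n om (numerals n)
      ... | inj₁ p = p
      ... | inj₂ e = ⊥-elim (not-m (finite-closed-adjoin (below _ (numerals n))) e)

  module _ {ℓ} (P : ℕ → Set ℓ) where

    -- P need not be definable in the model; the set exists because it is built by standardly many
    -- adjunctions.
    subset : ℕ → V
    subset zero    = ∅
    subset (suc n) with em {P = P n}
    ... | yes _ = adjoin (subset n) (numeral n)
    ... | no _  = subset n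

    ∈-subset⁺ : ∀ {i} n → i < n → P i → numeral i ∈ subset n
    ∈-subset⁺ (suc n) i<1+n p with em {P = P n} | m<1+n⇒m<n∨m≡n i<1+n
    ... | yes _ | inj₁ i<n  = from ∈-adjoin (inj₁ (∈-subset⁺ n i<n p))
    ... | yes _ | inj₂ refl = from ∈-adjoin (inj₂ refl)
    ... | no _  | inj₁ i<n  = ∈-subset⁺ n i<n p
    ... | no ¬p | inj₂ refl = ⊥-elim (¬p p)

    ∈-subset⁻ : ∀ {z} n → z ∈ subset n → ∃[ i ] (i < n × P i × z ≡ numeral i)
    ∈-subset⁻ zero q = ⊥-elim (∉∅ q)
    ∈-subset⁻ (suc n) q with em {P = P n}
    ... | no _  = let (i , i<n , p , e) = ∈-subset⁻ n q in i , m<n⇒m<1+n i<n , p , e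
    ... | yes p with to ∈-adjoin q
    ... | inj₁ r = let (i , i<n , p , e) = ∈-subset⁻ n r in i , m<n⇒m<1+n i<n , p , e
    ... | inj₂ e = n , n<1+n n , p , e

    numeral∈subset : ∀ {i} n → numeral i ∈ subset n → i < n × P i
    numeral∈subset {i} n q with ∈-subset⁻ n q
    ... | j , j<n , p , e with refl ← numeral-injective {i} {j} e = j<n , p

    subset∈ : ∀ {K} n i → i ≤ n → FiniteClosed (numeral n) K → subset i ∈ K
    subset∈ n zero    _   (p , _) = p
    subset∈ n (suc i) i<n c with em {P = P i}
    ... | yes _ = proj₂ c _ (subset∈ n i (<⇒≤ i<n) c) _ (numeral-mono i<n)
    ... | no _  = subset∈ n i (<⇒≤ i<n) c

    top-in : ∀ n → P n → ∀ {l} → ⟦ top-in′ 0F 1F ⟧ (subset (suc n) ∷ l ∷ []) ⇔ numeral n ∈ l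
    top-in n p {l} = mk⇔ f g
      where
      f : ⟦ top-in′ 0F 1F ⟧ (subset (suc n) ∷ l ∷ []) → numeral n ∈ l
      f (m , m∈ , m∈l , max) with max (numeral n) (∈-subset⁺ (suc n) (n<1+n n) p)
      ... | inj₁ (lift e) = subst (_∈ l) (sym e) m∈l
      ... | inj₂ q with ∈-subset⁻ (suc n) m∈
      ... | i , i<1+n , _ , refl = ⊥-elim (<⇒≱ (numeral-reflect q) (m<1+n⇒m≤n i<1+n))
      g : numeral n ∈ l → ⟦ top-in′ 0F 1F ⟧ (subset (suc n) ∷ l ∷ [])
      g q = numeral n , ∈-subset⁺ (suc n) (n<1+n n) p , q , max
        where
        max : ∀ z → z ∈ subset (suc n) → Lift b (z ≡ numeral n) ⊎ z ∈ numeral n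
        max z z∈ with ∈-subset⁻ (suc n) z∈
        ... | i , i<1+n , _ , refl with m<1+n⇒m<n∨m≡n i<1+n
        ... | inj₁ i<n  = inj₂ (numeral-mono i<n)
        ... | inj₂ refl = inj₁ (lift refl)

  -- Models whose ordinals are standard numerals

  fromList : List V → V
  fromList []       = ∅
  fromList (x ∷ xs) = adjoin (fromList xs) x

  ∈-fromList : ∀ xs {z} → z ∈ fromList xs ⇔ z ∈ˡ xs
  ∈-fromList []       = mk⇔ (λ p → ⊥-elim (∉∅ p)) λ ()
  ∈-fromList (x ∷ xs) = mk⇔
    ([ there ∘ to (∈-fromList xs) , here ]′ ∘ to ∈-adjoin)
    (λ { (here e) → from ∈-adjoin (inj₂ e)
       ; (there p) → from ∈-adjoin (inj₁ (from (∈-fromList xs) p)) })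

  module Finite (h : ∀ x → Ordinal x → ¬ HasNumerals x) where

    -- Some numeral is missing from x, so x equals it or is one of its elements.
    ordinal-numeral : ∀ x → Ordinal x → ∃[ n ] x ≡ numeral n
    ordinal-numeral x ox with em {P = ∃[ n ] numeral n ∉ x}
    ... | no ¬n = ⊥-elim (h x ox λ n → decidable-stable em λ n∉x → ¬n (n , n∉x))
    ... | yes (n , n∉x) with compare (numeral n) x (numeral-ordinal n) ox
    ... | inj₁ p        = ⊥-elim (n∉x p)
    ... | inj₂ (inj₁ e) = n , sym e
    ... | inj₂ (inj₂ p) = let (i , _ , e) = ∈-numeral n p in i , e

    height : V → ℕ
    height x = proj₁ (ordinal-numeral (rank x) (rank-ordinal x))

    height-mono : ∀ {x y} → y ∈ x → height y < height x
    height-mono {x} {y} y∈x = numeral-reflect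
      (subst₂ _∈_ (proj₂ (ordinal-numeral (rank y) (rank-ordinal y)))
                  (proj₂ (ordinal-numeral (rank x) (rank-ordinal x))) (rank-mono y∈x))

    -- The power set of a finite list, formed externally.
    sets : List V → List V
    sets []       = ∅ ∷ []
    sets (x ∷ xs) = sets xs ++ map (λ s → adjoin s x) (sets xs)

    ∈-sets : ∀ x xs → (∀ z → z ∈ x → z ∈ˡ xs) → x ∈ˡ sets xs
    ∈-sets x xs x⊆xs = let (s , s∈ , sound , complete) = restrict xs in
      subst (_∈ˡ sets xs) (ext (λ z → sound) (λ z p → complete (x⊆xs z p) p)) s∈
      where
      restrict : ∀ xs → ∃[ s ] (s ∈ˡ sets xs × (∀ {z} → z ∈ s → z ∈ x) ×
                                (∀ {z} → z ∈ˡ xs → z ∈ x → z ∈ s))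
      restrict [] = ∅ , here refl , (λ p → ⊥-elim (∉∅ p)) , λ ()
      restrict (w ∷ ws) with restrict ws | em {P = w ∈ x}
      ... | s , s∈ , sound , complete | yes w∈x =
        adjoin s w , ∈-++⁺ʳ (sets ws) (∈-map⁺ (λ t → adjoin t w) s∈) ,
        ([ sound , (λ { refl → w∈x }) ]′ ∘ to ∈-adjoin) ,
        (λ { (here refl) _ → from ∈-adjoin (inj₂ refl)
           ; (there p) q → from ∈-adjoin (inj₁ (complete p q)) })
      ... | s , s∈ , sound , complete | no w∉x =
        s , ∈-++⁺ˡ s∈ , sound ,
        (λ { (here refl) q → ⊥-elim (w∉x q) ; (there p) q → complete p q })

    -- The level Vₙ of the cumulative hierarchy as a list.
    level : ℕ → List V
    level zero    = []
    level (suc n) = sets (level n)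

    ∈-level : ∀ {x} n → height x < n → x ∈ˡ level n
    ∈-level {x} (suc n) p = ∈-sets x (level n) λ z z∈x →
      ∈-level n (<-≤-trans (height-mono z∈x) (m<1+n⇒m≤n p))

    members : V → List V
    members x = filter (λ z → em {P = z ∈ x}) (level (height x))

    ∈-members : ∀ {x z} → z ∈ x ⇔ z ∈ˡ members x
    ∈-members {x} = mk⇔
      (λ p → ∈-filter⁺ (λ z → em) (∈-level (height x) (height-mono p)) p)
      (λ p → proj₂ (∈-filter⁻ (λ z → em {P = z ∈ x}) {xs = level (height x)} p))

-- Embeddings between models and maps between their ordinals

module Embedding (em : ∀ {ℓ} → ExcludedMiddle ℓ)
                 {a b c d} (M : Structure a b) (N : Structure c d)
                 (kpM : IsModelOfKP M) (kpN : IsModelOfKP N) where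

  module M = KP em M kpM
  module N = KP em N kpN

  ordMap : EmbedsInto M N → OrdMapsInto M N
  ordMap (j , _ , h) =
    (λ α → N.rank (j (value α)) , [ to N.ordinal⇔ (N.rank-ordinal (j (value α))) ]) ,
    (λ p → lower (N.rank-mono (lift (to (h _ _) p))))

  -- The proof stored in a refinement is irrelevant; excluded middle recomputes it.
  value-ordinal : (α : Ord N) → N.Ordinal (value α)
  value-ordinal (x , [ p ]) = from N.ordinal⇔ (recompute em p)

  -- g stands for f composed with the rank function of M.
  module Graded (g : M.V → N.V) (g-ordinal : ∀ x → N.Ordinal (g x))
                (g-mono : ∀ {x y} → x M.∈ y → g x N.∈ g y) where

    HasNumerals-g : ∀ x → M.HasNumerals x → N.HasNumerals (g x)
    HasNumerals-g x h n with below n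
      where
      -- A strictly increasing map satisfies n ≤ g(n), by external induction.
      below : ∀ n → N.numeral n N.∈ g (M.numeral n) ⊎ N.numeral n ≡ g (M.numeral n)
      below zero with N.compare N.∅ (g M.∅) N.∅-ordinal (g-ordinal M.∅)
      ... | inj₁ p        = inj₁ p
      ... | inj₂ (inj₁ e) = inj₂ e
      ... | inj₂ (inj₂ p) = ⊥-elim (N.∉∅ p)
      below (suc n) = N.numeral-suc n (g-ordinal _)
        ([ proj₁ (g-ordinal _) _ step _
         , (λ e → subst (N._∈ g (M.numeral (suc n))) (sym e) step) ]′ (below n))
        where
        step : g (M.numeral n) N.∈ g (M.numeral (suc n))
        step = g-mono (M.numeral-mono (n<1+n n))
    ... | inj₁ p = proj₁ (g-ordinal x) _ (g-mono (h n)) _ p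
    ... | inj₂ e = subst (N._∈ g x) (sym e) (g-mono (h n))

    -- The embedding when no ordinal of M contains every numeral

    module Finite (h : ∀ x → M.Ordinal x → ¬ M.HasNumerals x) where
      open M.Finite h

      -- Recursion along ∈ with fuel: the value is the intended one once the fuel exceeds the height
      -- of x, and ∅ is a default for exhausted fuel.
      approx : ℕ → M.V → N.V
      approx zero    x = N.∅
      approx (suc n) x = N.fromList (map (approx n) (members x))

      ∈-approx : ∀ n {x z} → z N.∈ approx (suc n) x ⇔ (∃[ y ] (y M.∈ x × z ≡ approx n y))
      ∈-approx n {x} = mk⇔
        (λ p → let (y , y∈ , e) = ∈-map⁻ (approx n) (to (N.∈-fromList _) p)
               in y , from ∈-members y∈ , e)
        (λ { (y , y∈x , refl) → from (N.∈-fromList _) (∈-map⁺ (approx n) (to ∈-members y∈x)) })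

      approx-stable : ∀ n m {x} → height x < n → height x < m → approx n x ≡ approx m x
      approx-stable (suc n) (suc m) {x} p q = N.ext (half n m p q) (half m n q p)
        where
        half : ∀ n m → height x < suc n → height x < suc m →
               ∀ z → z N.∈ approx (suc n) x → z N.∈ approx (suc m) x
        half n m p q z z∈ =
          let (y , y∈x , e) = to (∈-approx n) z∈
              y<x = M.Finite.height-mono h y∈x
          in from (∈-approx m) (y , y∈x , trans e
               (approx-stable n m (<-≤-trans y<x (m<1+n⇒m≤n p)) (<-≤-trans y<x (m<1+n⇒m≤n q))))

      j : M.V → N.V
      j x = approx (suc (height x)) x

      ∈-j : ∀ {x z} → z N.∈ j x ⇔ (∃[ y ] (y M.∈ x × z ≡ j y))
      ∈-j {x} = mk⇔
        (λ p → let (y , y∈x , e) = to (∈-approx (height x)) p in y , y∈x , trans e (same y∈x))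
        (λ (y , y∈x , e) → from (∈-approx (height x)) (y , y∈x , trans e (sym (same y∈x))))
        where
        same : ∀ {y} → y M.∈ x → approx (height x) y ≡ j y
        same {y} y∈x = approx-stable (height x) (suc (height y)) (height-mono y∈x) (n<1+n _)

      j-injective : ∀ {x y} → j x ≡ j y → x ≡ y
      j-injective {x} = go (suc (height x)) (n<1+n _)
        where
        -- It suffices to bound the height of x, since each recursive call compares an element of x
        -- with one of y.
        go : ∀ n {x y} → height x < n → j x ≡ j y → x ≡ y
        go (suc n) {x} {y} p e = M.ext
          (λ z z∈x →
            let (w , w∈y , q) = to ∈-j (subst (j z N.∈_) e (from ∈-j (z , z∈x , refl)))
            in subst (M._∈ y) (sym (go n (<-≤-trans (height-mono z∈x) (m<1+n⇒m≤n p)) q)) w∈y)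
          (λ z z∈y →
            let (w , w∈x , q) = to ∈-j (subst (j z N.∈_) (sym e) (from ∈-j (z , z∈y , refl)))
            in subst (M._∈ x) (go n (<-≤-trans (height-mono w∈x) (m<1+n⇒m≤n p)) (sym q)) w∈x)

      embedding : EmbedsInto M N
      embedding = j , j-injective , λ x y → mk⇔
        (λ p → lower (from ∈-j (x , lift p , refl)))
        (λ p → let (z , z∈y , e) = to ∈-j (lift p) in
               lower (subst (M._∈ y) (sym (j-injective e)) z∈y))

    -- The embedding when some ordinal of N contains every numeral

    module Infinite (countable : Countable M) (δ : N.V)
                    (δ-ordinal : N.Ordinal δ) (δ-numerals : N.HasNumerals δ) where

      index : M.V → ℕ
      index = Injection.to countable

      K : N.V
      K = proj₁ (N.finite-subsets δ δ-ordinal δ-numerals)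

      -- The index of x is included so that it is the largest numeral in `code x` and determines x.
      -- The relation to y is symmetric; its direction is recovered from g.
      Linked : M.V → ℕ → Set (a ⊔ b)
      Linked x i = i ≡ index x ⊎ ∃[ y ] (index y ≡ i × (y M.∈ x ⊎ x M.∈ y))

      code : M.V → N.V
      code x = N.subset (Linked x) (suc (index x))

      code∈K : ∀ x → code x N.∈ K
      code∈K x =
        let n = suc (index x)
            (L , p , L⊆K) = proj₂ (N.finite-subsets δ δ-ordinal δ-numerals) n
        in L⊆K _ (N.subset∈ (Linked x) n n ≤-refl p)

      Linked-index : ∀ {x y} → Linked x (index y) → y ≡ x ⊎ y M.∈ x ⊎ x M.∈ y
      Linked-index (inj₁ e) = inj₁ (Injection.injective countable e)
      Linked-index (inj₂ (z , e , p)) with refl ← Injection.injective countable e = inj₂ p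

      numeral∈code : ∀ {x y} → N.numeral (index x) N.∈ code y →
                     index x ≤ index y × (x ≡ y ⊎ x M.∈ y ⊎ y M.∈ x)
      numeral∈code {x} {y} p =
        let (i<n , q) = N.numeral∈subset (Linked y) (suc (index y)) p
        in m<1+n⇒m≤n i<n , Linked-index q

      code-~⁺ : ∀ {x y} → x M.∈ y ⊎ y M.∈ x → index x ≤ index y →
                N.⟦ top-in′ 0F 1F ⟧ (code x ∷ code y ∷ [])
      code-~⁺ {x} {y} p x≤y = from (N.top-in (Linked x) (index x) (inj₁ refl))
        (N.∈-subset⁺ (Linked y) (suc (index y)) (s≤s x≤y) (inj₂ (x , refl , p)))

      -- A code records only neighbours of smaller index, so the element with the larger index is
      -- the one whose code records the link.
      ~-code : ∀ {x y} → x M.∈ y → code x N.~ code y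
      ~-code {x} {y} p with ≤-total (index x) (index y)
      ... | inj₁ x≤y = inj₁ (code-~⁺ (inj₁ p) x≤y)
      ... | inj₂ y≤x = inj₂ (code-~⁺ (inj₂ p) y≤x)

      code-~⁻ : ∀ {x y} → code x N.~ code y → x ≡ y ⊎ x M.∈ y ⊎ y M.∈ x
      code-~⁻ {x} (inj₁ p) = proj₂ (numeral∈code (to (N.top-in (Linked x) (index x) (inj₁ refl)) p))
      code-~⁻ {x} {y} (inj₂ p)
        with proj₂ (numeral∈code (to (N.top-in (Linked y) (index y) (inj₁ refl)) p))
      ... | inj₁ e        = inj₁ (sym e)
      ... | inj₂ (inj₁ q) = inj₂ (inj₂ q)
      ... | inj₂ (inj₂ q) = inj₂ (inj₁ q)

      code-injective : ∀ {x y} → code x ≡ code y → x ≡ y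
      code-injective {x} {y} e = Injection.injective countable (≤-antisym (half e) (half (sym e)))
        where
        half : ∀ {x y} → code x ≡ code y → index x ≤ index y
        half {x} {y} e = proj₁ (numeral∈code {x} {y} (subst (N.numeral (index x) N.∈_) e
          (N.∈-subset⁺ (Linked x) (suc (index x)) (n<1+n _) (inj₁ refl))))

      j : M.V → N.V
      j x = N.vertex K (g x) (code x) (code∈K x)

      -- The codes leave three cases; g x ∈ g y rules out x = y and, by monotonicity of g, y ∈ x.
      j-∈⁻ : ∀ {x y} → j x N.∈ j y → x M.∈ y
      j-∈⁻ {x} {y} p with N.vertex-∈⁻ K p
      ... | gx∈gy , r with code-~⁻ r
      ... | inj₁ refl     = ⊥-elim (N.∈-irrefl gx∈gy)
      ... | inj₂ (inj₁ q) = q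
      ... | inj₂ (inj₂ q) = ⊥-elim (N.∈-irrefl (proj₁ (g-ordinal y) _ gx∈gy _ (g-mono q)))

      embedding : EmbedsInto M N
      embedding = j , (λ e → code-injective (proj₂ (N.vertex-injective K e))) , λ x y → mk⇔
        (λ p → lower (N.vertex-∈⁺ K (g-mono (lift p)) (~-code (lift p))))
        (λ p → lower (j-∈⁻ (lift p)))

    embedding : Countable M → EmbedsInto M N
    embedding countable with em {P = ∃[ δ ] (N.Ordinal δ × N.HasNumerals δ)}
    ... | yes (δ , o , h) = Infinite.embedding countable δ o h
    -- An ordinal x of M with all numerals would make g x such an ordinal of N.
    ... | no ¬δ = Finite.embedding λ x _ h → ¬δ (g x , g-ordinal x , HasNumerals-g x h)

corollary28 : (∀ {ℓ} → ExcludedMiddle ℓ) →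
    ∀ {a b c d} (M : Structure a b) (N : Structure c d) →
    IsModelOfKP M → IsModelOfKP N → Countable M →
    EmbedsInto M N ⇔ OrdMapsInto M N
corollary28 em M N kpM kpN countable = mk⇔ ordMap λ (f , f-mono) →
  let α = λ x → M.rank x , [ to M.ordinal⇔ (M.rank-ordinal x) ] in
  Graded.embedding (value ∘ f ∘ α) (value-ordinal ∘ f ∘ α)
    (λ p → lift (f-mono (lower (M.rank-mono p)))) countable
  where open Embedding em M N kpM kpN
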